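{- Let $G$ be a connected graph with girth at least $5$ and $G\neq C_6$, and let $\Delta$ be the maximum degree of $G$. Then $\chi_D(G)\le \Delta+1$.
   Context: A $k$-coloring of a graph $G$ is a map $\varphi:V(G)\to\{1,\dots,k\}$; it is proper if $\varphi(v)\ne\varphi(w)$ whenever $vw\in E(G)$. A coloring $\varphi$ is distinguishing if the only automorphism $f$ of $G$ with $\varphi(f(v))=\varphi(v)$ for all $v\in V(G)$ is the identity. The distinguishing chromatic number $\chi_D(G)$ is the smallest number of colors in a proper distinguishing coloring of $G$. The girth of a graph containing no cycle is taken to be infinite (so trees satisfy the girth hypothesis). $C_6$ is the cycle on $6$ vertices. -}

module Defs where

open import Data.Nat using (ℕ; zero; suc; _≤_; _≤?_; z≤n; s≤s)
open import Data.Nat.DivMod using (_mod_)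
open import Data.Fin using (Fin; zero; suc; toℕ; fromℕ<)
open import Data.Fin.Properties using (_≟_; any?; all?; injective⇒≤; toℕ-fromℕ<)
open import Data.List using (length; filter; map; allFin)
open import Data.List.Extrema.Nat using (max)
open import Data.Product using (∃; _×_; _,_; proj₁; proj₂)
open import Data.Sum using (_⊎_; swap)
open import Data.Vec.Functional using (Vector; []; _∷_; head; tail)
open import Function using (_∘_; id; _↔_; _⇔_; Injective; mk↔ₛ′; mk⇔)
open import Function.Bundles using (module Inverse; module Equivalence)
open import Level using (0ℓ)
open import Relation.Binary using (Rel; Symmetric; Irreflexive; _Respects_)
import Relation.Binary as B
import Relation.Binary.Construct.Add.Supremum.NonStrict as Supremum
open import Relation.Binary.Construct.Closure.ReflexiveTransitive using (Star)
open import Relation.Binary.PropositionalEquality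
  using (_≡_; _≢_; _≗_; refl; sym; trans; cong; subst; subst₂)
open import Relation.Nullary using (¬_; Dec; yes; no; contradiction)
open import Relation.Nullary.Construct.Add.Supremum using (_⁺; [_]; ⊤⁺)
open import Relation.Nullary.Decidable
  using (map′; ¬?; _×-dec_; _⊎-dec_; _→-dec_; toWitness)
open import Relation.Unary using (Pred; Decidable)

private
  variable
    m n k : ℕ

record Graph (n : ℕ) : Set₁ where
  field
    Adj     : Rel (Fin n) 0ℓ
    adj?    : B.Decidable Adj
    symm    : Symmetric Adj
    irrefl  : Irreflexive _≡_ Adj

open Graph public

-- The null graph does not count as connected.
Connected : Graph n → Set
Connected {n} G = Fin n × (∀ v w → Star (Adj G) v w)

degree : Graph n → Fin n → ℕ
degree {n} G v = length (filter (adj? G v) (allFin n))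

Δ : Graph n → ℕ
Δ {n} G = max 0 (map (degree G) (allFin n))

record _≅_ (G : Graph m) (H : Graph n) : Set where
  field
    bijection : Fin m ↔ Fin n
  open Inverse bijection public using (to; from)
  field
    preserves : ∀ v w → Adj G v w ⇔ Adj H (to v) (to w)

Automorphism : Graph n → Set
Automorphism G = G ≅ G

-- Cyclic successor: i ↦ i + 1 modulo n.
next : Fin n → Fin n
next {suc n} i = suc (toℕ i) mod suc n

C₆ : Graph 6
C₆ = record
  { Adj    = λ i j → j ≡ next i ⊎ i ≡ next j
  ; adj?   = λ i j → (j ≟ next i) ⊎-dec (i ≟ next j)
  ; symm   = swap
  ; irrefl = λ { {i} refl → toWitness {a? = all? λ i →
      ¬? ((i ≟ next i) ⊎-dec (i ≟ next i))} _ i }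
  }

HasCycle : Graph n → ℕ → Set
HasCycle {n} G ℓ = 3 ≤ ℓ × ∃ λ (c : Fin ℓ → Fin n) →
  Injective _≡_ _≡_ c × (∀ i → Adj G (c i) (c (next i)))

Coloring : ℕ → Graph n → Set
Coloring {n} k G = Fin n → Fin k

Proper : (G : Graph n) → Coloring k G → Set
Proper G φ = ∀ v w → Adj G v w → φ v ≢ φ w

Distinguishing : (G : Graph n) → Coloring k G → Set
Distinguishing G φ = (f : Automorphism G) → let open _≅_ f in
  (∀ v → φ (to v) ≡ φ v) → ∀ v → to v ≡ v

HasProperDistinguishingColoring : Graph n → ℕ → Set
HasProperDistinguishingColoring G k =
  ∃ λ (φ : Coloring k G) → Proper G φ × Distinguishing G φ

IsLeast : Pred ℕ 0ℓ → ℕ → Set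
IsLeast P m = P m × (∀ k → P k → m ≤ k)

-- The supremum ⊤⁺ adjoined to ℕ plays the role of infinity.
IsGirth : Graph n → ℕ ⁺ → Set
IsGirth G [ ℓ ] = IsLeast (HasCycle G) ℓ
IsGirth G ⊤⁺    = ∀ ℓ → ¬ HasCycle G ℓ

open Supremum _≤_ public using (_≤⁺_)

-- The girth and the distinguishing chromatic number are obtained by
-- exhaustive search, so that both are total functions.

least : {P : Pred ℕ 0ℓ} → Decidable P → ∀ n → P n → ∃ (IsLeast P)
least P? zero    p = 0 , p , λ _ _ → z≤n
least P? (suc n) p with P? 0
... | yes p₀ = 0 , p₀ , λ _ _ → z≤n
... | no ¬p₀ with least (P? ∘ suc) n p
...   | m , pm , m-min = suc m , pm , λ
  { zero    p₀ → contradiction p₀ ¬p₀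
  ; (suc k) pk → s≤s (m-min k pk) }

∷-η : {A : Set} (f : Vector A (suc m)) → (head f ∷ tail f) ≗ f
∷-η f zero    = refl
∷-η f (suc i) = refl

∷-cong : {A : Set} {x : A} {f g : Vector A m} → f ≗ g → (x ∷ f) ≗ (x ∷ g)
∷-cong f≗g zero    = refl
∷-cong f≗g (suc i) = f≗g i

anyFunction? : {P : Pred (Fin m → Fin n) 0ℓ} → P Respects _≗_ →
               Decidable P → Dec (∃ P)
anyFunction? {zero} resp P? =
  map′ (λ p → [] , p) (λ (f , p) → resp (λ ()) p) (P? [])
anyFunction? {suc m} resp P? =
  map′ (λ (x , f , p) → (x ∷ f) , p)
       (λ (f , p) → head f , tail f , resp (sym ∘ ∷-η f) p)
       (any? λ x → anyFunction? (resp ∘ ∷-cong) (P? ∘ (x ∷_)))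

allFunctions? : {P : Pred (Fin m → Fin n) 0ℓ} → P Respects _≗_ →
                Decidable P → Dec (∀ f → P f)
allFunctions? {zero} resp P? =
  map′ (λ p f → resp (λ ()) p) (λ p → p []) (P? [])
allFunctions? {suc m} resp P? =
  map′ (λ p f → resp (∷-η f) (p (head f) (tail f)))
       (λ p x f → p (x ∷ f))
       (all? λ x → allFunctions? (resp ∘ ∷-cong) (P? ∘ (x ∷_)))

hasCycle? : (G : Graph n) → Decidable (HasCycle G)
hasCycle? {n} G ℓ = (3 ≤? ℓ) ×-dec anyFunction? resp λ c →
  map′ (λ inj {i} {j} → inj i j) (λ inj i j → inj {i} {j})
    (all? λ i → all? λ j → (c i ≟ c j) →-dec (i ≟ j))
  ×-dec all? λ i → adj? G (c i) (c (next i))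
  where
  resp : (λ (c : Fin ℓ → Fin n) →
    Injective _≡_ _≡_ c × (∀ i → Adj G (c i) (c (next i)))) Respects _≗_
  resp c≗d (inj , adj) =
    (λ {i} {j} e → inj (trans (c≗d i) (trans e (sym (c≗d j))))) ,
    (λ i → subst₂ (Adj G) (c≗d i) (c≗d (next i)) (adj i))

girth-exists : (G : Graph n) → ∃ (IsGirth G)
girth-exists {n} G with any? {suc n} (λ i → hasCycle? G (toℕ i))
... | yes (i , c) = let ℓ , p = least (hasCycle? G) (toℕ i) c in [ ℓ ] , p
... | no ¬c = ⊤⁺ , λ { ℓ c@(_ , _ , inj , _) →
  ¬c (fromℕ< (s≤s (injective⇒≤ inj)) ,
      subst (HasCycle G) (sym (toℕ-fromℕ< (s≤s (injective⇒≤ inj)))) c) }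

girth : Graph n → ℕ ⁺
girth G = proj₁ (girth-exists G)

module _ (G : Graph n) where

  proper? : (φ : Coloring k G) → Dec (Proper G φ)
  proper? φ = all? λ v → all? λ w → adj? G v w →-dec ¬? (φ v ≟ φ w)

  private
    Moves : Rel (Fin n → Fin n) 0ℓ
    Moves f g = (∀ v → f (g v) ≡ v) × (∀ v → g (f v) ≡ v) ×
      (∀ v w → (Adj G v w → Adj G (f v) (f w)) ×
               (Adj G (f v) (f w) → Adj G v w))

    Fixes : Coloring k G → Rel (Fin n → Fin n) 0ℓ
    Fixes φ f g = Moves f g → (∀ v → φ (f v) ≡ φ v) → ∀ v → f v ≡ v

    fixes? : (φ : Coloring k G) → B.Decidable (Fixes φ)
    fixes? φ f g =
      ((all? λ v → f (g v) ≟ v) ×-dec (all? λ v → g (f v) ≟ v) ×-dec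
       (all? λ v → all? λ w →
         (adj? G v w →-dec adj? G (f v) (f w)) ×-dec
         (adj? G (f v) (f w) →-dec adj? G v w)))
      →-dec (all? λ v → φ (f v) ≟ φ v) →-dec (all? λ v → f v ≟ v)

    moves-resp : ∀ {f f′ g g′} → f ≗ f′ → g ≗ g′ → Moves f g → Moves f′ g′
    moves-resp {f} {f′} {g} {g′} p q (fg , gf , adj) =
      (λ v → trans (sym (trans (cong f (q v)) (p (g′ v)))) (fg v)) ,
      (λ v → trans (sym (trans (cong g (p v)) (q (f′ v)))) (gf v)) ,
      λ v w → (λ a → subst₂ (Adj G) (p v) (p w) (proj₁ (adj v w) a)) ,
              (λ a → proj₂ (adj v w) (subst₂ (Adj G) (sym (p v)) (sym (p w)) a))

    fixes-resp : (φ : Coloring k G) → ∀ {f f′ g g′} →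
                 f ≗ f′ → g ≗ g′ → Fixes φ f g → Fixes φ f′ g′
    fixes-resp φ p q fix mv col v = trans (sym (p v))
      (fix (moves-resp (sym ∘ p) (sym ∘ q) mv)
           (λ w → trans (cong φ (p w)) (col w)) v)

  distinguishing? : (φ : Coloring k G) → Dec (Distinguishing G φ)
  distinguishing? φ = map′ to′ from′
    (allFunctions? (λ p fix g → fixes-resp φ p (λ _ → refl) (fix g)) λ f →
     allFunctions? (λ q → fixes-resp φ {f} (λ _ → refl) q) λ g →
     fixes? φ f g)
    where
    to′ : (∀ f g → Fixes φ f g) → Distinguishing G φ
    to′ fix α = fix to from
      ( Inverse.strictlyInverseˡ bijection
      , Inverse.strictlyInverseʳ bijection
      , λ v w → Equivalence.to (preserves v w) , Equivalence.from (preserves v w))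
      where open _≅_ α

    from′ : Distinguishing G φ → ∀ f g → Fixes φ f g
    from′ dist f g (fg , gf , adj) = dist (record
      { bijection = mk↔ₛ′ f g fg gf
      ; preserves = λ v w → mk⇔ (proj₁ (adj v w)) (proj₂ (adj v w)) })

  hasProperDistinguishingColoring? : Decidable (HasProperDistinguishingColoring G)
  hasProperDistinguishingColoring? k = anyFunction?
    (λ p (proper , dist) →
      (λ v w a e → proper v w a (trans (p v) (trans e (sym (p w))))) ,
      (λ α col → dist α λ v → trans (p _) (trans (col v) (sym (p v)))))
    (λ φ → proper? φ ×-dec distinguishing? φ)

  -- Giving every vertex its own color is proper and distinguishing.
  χ-D-exists : ∃ (IsLeast (HasProperDistinguishingColoring G))
  χ-D-exists = least hasProperDistinguishingColoring? n
    (id , (λ v w a e → irrefl G e a) , (λ _ fix → fix))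

  χ-D : ℕ
  χ-D = proj₁ χ-D-exists

{-# OPTIONS --safe #-}

-- Color outwards from a root r of color c₀ with Δ + 1 colors, one neighborhood N(p) at a time.
-- If a color-preserving automorphism fixes everything colored so far, then it also fixes the new
-- vertices: those with two colored neighbors because there is no 4-cycle, and the others because
-- they receive different colors.  A vertex with two colored neighbors may be forced to take c₀,
-- but only when it has a neighbor of color c₁; all other vertices avoid c₀.  Hence r is fixed as
-- soon as no neighbor of r has color c₁.  If deg r < Δ, then N(r) can be colored injectively
-- without c₀ and c₁.  If G is Δ-regular, then two neighbors x and y of r share a color, and they are
-- told apart by a vertex z of color c₀ adjacent to x.  This needs z to have a neighbor of color c₁,
-- which can be arranged unless r, x, z and y lie on a 6-cycle that is all of G.
module Submission where

open import Defs
open import Data.Nat using (ℕ; suc; _≤_; _<_; _+_; z≤n; s≤s)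
open import Data.Nat.Properties
  using (m≤m+n; ≤-antisym; ≤-trans; ≤-reflexive; ≰⇒>; <⇒≱; ≮⇒≥; +-suc; +-comm; _≤?_; _<?_)
open import Data.Empty using (⊥)
open import Data.Fin using (Fin; zero)
open import Data.Fin.Patterns using (0F; 1F; 2F; 3F; 4F; 5F)
open import Data.Fin.Properties using (_≟_; any?; all?)
open import Data.List using (List; []; _∷_; length; filter; map; allFin)
open import Data.List.Extrema.Nat using (xs≤max)
open import Data.List.Properties using (filter-notAll; length-tabulate; length-map)
open import Data.List.Membership.Propositional using (_∈_; _∉_; lose; find)
open import Data.List.Membership.Propositional.Properties
  using (∈-filter⁺; ∈-filter⁻; ∈-allFin; ∈-map⁺)
import Data.List.Membership.DecPropositional as DecMembership
open import Data.List.Relation.Binary.Subset.Propositional using (_⊆_)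
open import Data.List.Relation.Unary.All as All using (All; []; _∷_)
open import Data.List.Relation.Unary.All.Properties using (All¬⇒¬Any; ¬All⇒Any¬)
open import Data.List.Relation.Unary.Any using (here; there)
open import Data.List.Relation.Unary.AllPairs using ([]; _∷_)
open import Data.List.Relation.Unary.Unique.Propositional using (Unique)
import Data.List.Relation.Unary.Unique.Propositional.Properties as Unique
open import Data.Product using (∃; _×_; _,_; proj₁; proj₂)
open import Data.Sum as Sum using (_⊎_; inj₁; inj₂)
open import Data.Vec.Functional using (updateAt) renaming ([] to []ᶠ; _∷_ to _∷ᶠ_)
open import Data.Vec.Functional.Properties using (updateAt-updates; updateAt-minimal)
open import Function using (_∘_; const; id)
open import Function.Bundles using (module Inverse; module Equivalence; mk⇔; mk↔ₛ′)
open import Level using (0ℓ)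
open import Relation.Binary.Construct.Add.Supremum.NonStrict using ([≤]-injective)
open import Relation.Binary.Construct.Closure.ReflexiveTransitive using (Star; ε; _◅_)
open import Relation.Binary.PropositionalEquality
  using (_≡_; _≢_; refl; sym; trans; cong; subst; subst₂; ≢-sym)
open import Relation.Nullary using (¬_; Dec; yes; no; contradiction)
open import Relation.Nullary.Construct.Add.Supremum using ([_]; ⊤⁺)
open import Relation.Nullary.Decidable using (¬?; _×-dec_; _⊎-dec_; decidable-stable; from-yes; toSum)
open import Relation.Unary using (Pred; Decidable)

private
  variable
    m n k : ℕ

-- Pigeonhole principle and rainbow colorings of a list

-- Induction on `xs`: deleting the head `x` from `ys` makes `ys` strictly shorter and keeps every
-- entry of the tail, where `x` does not recur.
unique-⊆⇒length≤ : {xs ys : List (Fin n)} → Unique xs → xs ⊆ ys → length xs ≤ length ys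
unique-⊆⇒length≤ {xs = []} _ _ = z≤n
unique-⊆⇒length≤ {xs = x ∷ xs} {ys} (x∉xs ∷ u) xs⊆ys = ≤-trans
  (s≤s (unique-⊆⇒length≤ u λ w∈xs → ∈-filter⁺ (λ w → ¬? (w ≟ x)) (xs⊆ys (there w∈xs))
    λ { refl → All¬⇒¬Any x∉xs w∈xs }))
  (filter-notAll (λ w → ¬? (w ≟ x)) ys (lose (xs⊆ys (here refl)) λ x≢x → x≢x refl))

fresh : {xs ys : List (Fin n)} → Unique xs → length ys < length xs → ∃ λ x → x ∈ xs × x ∉ ys
fresh {xs = xs} {ys} u ys<xs = find (¬All⇒Any¬ (λ x → DecMembership._∈?_ _≟_ x ys) xs λ xs⊆ys →
  <⇒≱ ys<xs (unique-⊆⇒length≤ u (All.lookup xs⊆ys)))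

freshColor : (bad : List (Fin k)) → length bad < k → ∃ λ c → c ∉ bad
freshColor {k} bad bad<k =
  let c , _ , c∉bad = fresh (Unique.allFin⁺ k) (≤-trans bad<k (≤-reflexive (sym (length-tabulate id))))
  in c , c∉bad

twoColors : 2 ≤ k → ∃ λ (c₀ : Fin k) → ∃ λ c₁ → c₀ ≢ c₁
twoColors 2≤k =
  let c₀ , _ = freshColor [] (≤-trans (s≤s z≤n) 2≤k)
      c₁ , c₁∉ = freshColor (c₀ ∷ []) 2≤k
  in c₀ , c₁ , λ e → c₁∉ (here (sym e))

InjectiveOn : List (Fin m) → (Fin m → Fin k) → Set
InjectiveOn ws h = ∀ {v w} → v ∈ ws → w ∈ ws → h v ≡ h w → v ≡ w

-- Each vertex takes a color outside `bad`, and this color becomes bad for the remaining ones, so a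
-- single induction gives both injectivity and avoidance. The color `d` is only a default off `ws`.
rainbow : Fin k → (bad : List (Fin k)) (ws : List (Fin m)) → length bad + length ws ≤ k →
          ∃ λ (h : Fin m → Fin k) → InjectiveOn ws h × (∀ {v} → v ∈ ws → h v ∉ bad)
rainbow d bad [] _ = const d , (λ ()) , λ ()
rainbow {k} {m} d bad (x ∷ ws) fits = h , inj , avoids
  where
  fits′ : suc (length bad + length ws) ≤ k
  fits′ = subst (_≤ k) (+-suc (length bad) (length ws)) fits

  c,c∉bad = freshColor bad (≤-trans (s≤s (m≤m+n (length bad) (length ws))) fits′)
  c = proj₁ c,c∉bad
  rec = rainbow d (c ∷ bad) ws fits′
  h₀ = proj₁ rec

  h : Fin m → Fin k
  h = updateAt h₀ x (const c)

  h-new : h x ≡ c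
  h-new = updateAt-updates x h₀

  h-old : ∀ {v} → v ≢ x → h v ≡ h₀ v
  h-old v≢x = updateAt-minimal _ x h₀ v≢x

  tail-∈ : ∀ {v} → v ≢ x → v ∈ x ∷ ws → v ∈ ws
  tail-∈ v≢x (here v≡x) = contradiction v≡x v≢x
  tail-∈ v≢x (there v∈ws) = v∈ws

  avoids₀ : ∀ {v} → v ≢ x → v ∈ x ∷ ws → h v ∉ c ∷ bad
  avoids₀ v≢x v∈ hv∈ = proj₂ (proj₂ rec) (tail-∈ v≢x v∈) (subst (_∈ c ∷ bad) (h-old v≢x) hv∈)

  inj : InjectiveOn (x ∷ ws) h
  inj {v} {w} v∈ w∈ e with v ≟ x | w ≟ x
  ... | yes v≡x | yes w≡x = trans v≡x (sym w≡x)
  ... | yes refl | no w≢x = contradiction (here (trans (sym e) h-new)) (avoids₀ w≢x w∈)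
  ... | no v≢x | yes refl = contradiction (here (trans e h-new)) (avoids₀ v≢x v∈)
  ... | no v≢x | no w≢x = proj₁ (proj₂ rec) (tail-∈ v≢x v∈) (tail-∈ w≢x w∈)
                            (trans (sym (h-old v≢x)) (trans e (h-old w≢x)))

  avoids : ∀ {v} → v ∈ x ∷ ws → h v ∉ bad
  avoids {v} v∈ hv∈ with v ≟ x
  ... | yes refl = proj₂ c,c∉bad (subst (_∈ bad) h-new hv∈)
  ... | no v≢x = avoids₀ v≢x v∈ (there hv∈)

-- Neighborhoods and automorphisms

module Neighbors (G : Graph n) where

  N : Fin n → List (Fin n)
  N v = filter (adj? G v) (allFin n)

  ∈N⁺ : ∀ {v w} → Adj G v w → w ∈ N v
  ∈N⁺ {v} = ∈-filter⁺ (adj? G v) (∈-allFin _)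

  ∈N⁻ : ∀ {v w} → w ∈ N v → Adj G v w
  ∈N⁻ {v} w∈ = proj₂ (∈-filter⁻ (adj? G v) {xs = allFin n} w∈)

  N-unique : ∀ v → Unique (N v)
  N-unique v = Unique.filter⁺ (adj? G v) (Unique.allFin⁺ n)

  length≤degree : ∀ {v ws} → Unique ws → All (Adj G v) ws → length ws ≤ degree G v
  length≤degree u adj = unique-⊆⇒length≤ u λ w∈ → ∈N⁺ (All.lookup adj w∈)

  anotherNeighbor : ∀ v (bad : List (Fin n)) → length bad < degree G v → ∃ λ w → Adj G v w × w ∉ bad
  anotherNeighbor v bad bad<deg = let w , w∈ , w∉ = fresh (N-unique v) bad<deg in w , ∈N⁻ w∈ , w∉

  adj⇒≢ : ∀ {v w} → Adj G v w → v ≢ w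
  adj⇒≢ a e = irrefl G e a

  degree≤Δ : ∀ v → degree G v ≤ Δ G
  degree≤Δ v = All.lookup (xs≤max 0 (map (degree G) (allFin n))) (∈-map⁺ (degree G) (∈-allFin v))

module Automorphisms {G : Graph n} (α : Automorphism G) where

  open _≅_ α public

  to-from : ∀ v → to (from v) ≡ v
  to-from = Inverse.strictlyInverseˡ bijection

  to-injective : ∀ {v w} → to v ≡ to w → v ≡ w
  to-injective {v} {w} e = trans (sym (Inverse.strictlyInverseʳ bijection v))
                             (trans (cong from e) (Inverse.strictlyInverseʳ bijection w))

  to-adj⁻ : ∀ {v w} → Adj G (to v) (to w) → Adj G v w
  to-adj⁻ {v} {w} = Equivalence.from (preserves v w)

  fixed-adj : ∀ {v w} → to v ≡ v → Adj G v w → Adj G v (to w)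
  fixed-adj {v} {w} e a = subst (λ u → Adj G u (to w)) e (Equivalence.to (preserves v w) a)

-- From the girth to forbidden short cycles

-- The form in which the girth enters all later arguments; `common-unique` is the absence of
-- 4-cycles.
record Girth≥5 (G : Graph n) : Set where
  field
    no-triangle : ∀ {a b c} → Adj G a b → Adj G b c → ¬ Adj G c a
    common-unique : ∀ {a b u v} → a ≢ b → Adj G a u → Adj G b u → Adj G a v → Adj G b v → u ≡ v

-- Taking the pair `g` as an argument lets `acyclic` split on whether the girth is finite.
girth≥5⇒Girth≥5 : (G : Graph n) (g : ∃ (IsGirth G)) → [ 5 ] ≤⁺ proj₁ g → Girth≥5 G
girth≥5⇒Girth≥5 {n} G g 5≤g = record
  { no-triangle = λ a~b b~c c~a → acyclic g 5≤g (s≤s (s≤s (s≤s (s≤s z≤n)))) (triangle a~b b~c c~a)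
  ; common-unique = λ {a} {b} {u} {v} a≢b a~u b~u a~v b~v → decidable-stable (u ≟ v) λ u≢v →
      acyclic g 5≤g (s≤s (s≤s (s≤s (s≤s (s≤s z≤n)))))
        (square a~u (symm G b~u) b~v (symm G a~v) a≢b u≢v)
  }
  where
  open Neighbors G using (adj⇒≢)

  acyclic : (g : ∃ (IsGirth G)) → [ 5 ] ≤⁺ proj₁ g → ∀ {ℓ} → ℓ < 5 → ¬ HasCycle G ℓ
  acyclic ([ _ ] , _ , minimal) 5≤g ℓ<5 cycle =
    <⇒≱ ℓ<5 (≤-trans ([≤]-injective _≤_ 5≤g) (minimal _ cycle))
  acyclic (⊤⁺ , none) _ _ cycle = none _ cycle

  triangle : ∀ {a b c} → Adj G a b → Adj G b c → Adj G c a → HasCycle G 3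
  triangle {a} {b} {c} a~b b~c c~a = s≤s (s≤s (s≤s z≤n)) , cycle , inj _ _ , adj
    where
    cycle : Fin 3 → Fin n
    cycle = a ∷ᶠ b ∷ᶠ c ∷ᶠ []ᶠ
    inj : ∀ i j → cycle i ≡ cycle j → i ≡ j
    inj 0F 0F _ = refl
    inj 1F 1F _ = refl
    inj 2F 2F _ = refl
    inj 0F 1F e = contradiction e (adj⇒≢ a~b)
    inj 1F 0F e = contradiction (sym e) (adj⇒≢ a~b)
    inj 1F 2F e = contradiction e (adj⇒≢ b~c)
    inj 2F 1F e = contradiction (sym e) (adj⇒≢ b~c)
    inj 2F 0F e = contradiction e (adj⇒≢ c~a)
    inj 0F 2F e = contradiction (sym e) (adj⇒≢ c~a)
    adj : ∀ i → Adj G (cycle i) (cycle (next i))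
    adj 0F = a~b
    adj 1F = b~c
    adj 2F = c~a

  square : ∀ {a b c d} → Adj G a b → Adj G b c → Adj G c d → Adj G d a → a ≢ c → b ≢ d → HasCycle G 4
  square {a} {b} {c} {d} a~b b~c c~d d~a a≢c b≢d =
    s≤s (s≤s (s≤s z≤n)) , cycle , inj _ _ , adj
    where
    cycle : Fin 4 → Fin n
    cycle = a ∷ᶠ b ∷ᶠ c ∷ᶠ d ∷ᶠ []ᶠ
    inj : ∀ i j → cycle i ≡ cycle j → i ≡ j
    inj 0F 0F _ = refl
    inj 1F 1F _ = refl
    inj 2F 2F _ = refl
    inj 3F 3F _ = refl
    inj 0F 1F e = contradiction e (adj⇒≢ a~b)
    inj 1F 0F e = contradiction (sym e) (adj⇒≢ a~b)
    inj 1F 2F e = contradiction e (adj⇒≢ b~c)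
    inj 2F 1F e = contradiction (sym e) (adj⇒≢ b~c)
    inj 2F 3F e = contradiction e (adj⇒≢ c~d)
    inj 3F 2F e = contradiction (sym e) (adj⇒≢ c~d)
    inj 3F 0F e = contradiction e (adj⇒≢ d~a)
    inj 0F 3F e = contradiction (sym e) (adj⇒≢ d~a)
    inj 0F 2F e = contradiction e a≢c
    inj 2F 0F e = contradiction (sym e) a≢c
    inj 1F 3F e = contradiction e b≢d
    inj 3F 1F e = contradiction (sym e) b≢d
    adj : ∀ i → Adj G (cycle i) (cycle (next i))
    adj 0F = a~b
    adj 1F = b~c
    adj 2F = c~d
    adj 3F = d~a

-- Partial colorings and their extension by one neighborhood

-- `Base` is what is assumed of an automorphism before rigidity is derived: that it fixes `r` and,
-- in the regular case, also `x`. `Exempt` is empty in the irregular case and consists of `z` in the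
-- regular one.
module Greedy (G : Graph n) (girth≥5 : Girth≥5 G) (degree<k : ∀ v → degree G v < k)
              (r : Fin n) (Base : Automorphism G → Set) (Exempt : Pred (Fin n) 0ℓ)
              (c₀ c₁ : Fin k) (c₀≢c₁ : c₀ ≢ c₁) where

  open Neighbors G
  open Girth≥5 girth≥5

  -- Colorings are total functions with arbitrary values off `S`, so colors are compared only when
  -- both `v` and its image lie in `S`.
  Preserves : Pred (Fin n) 0ℓ → (Fin n → Fin k) → Automorphism G → Set
  Preserves S φ α = ∀ v → S v → S (to v) → φ (to v) ≡ φ v
    where open _≅_ α

  -- An exempt vertex has color c₀, but gets its neighbor of color c₁ only later.
  record Partial : Set₁ where
    field
      Colored  : Pred (Fin n) 0ℓ
      colored? : Decidable Colored
      color    : Fin n → Fin k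

    Marked : Fin n → Set
    Marked v = ∃ λ u → Colored u × Adj G v u × color u ≡ c₁

    field
      proper : ∀ {v w} → Colored v → Colored w → Adj G v w → color v ≢ color w
      linked : ∀ {v} → Colored v → v ≡ r ⊎ ∃ λ q → Colored q × Adj G v q
      marked : ∀ {v} → Colored v → color v ≡ c₀ → v ≡ r ⊎ Exempt v ⊎ Marked v
      rigid  : ∀ α → Base α → Preserves Colored color α → ∀ {v} → Colored v → _≅_.to α v ≡ v

  open Partial

  infix 4 _⊑_
  record _⊑_ (P Q : Partial) : Set where
    field
      grows  : ∀ {v} → Colored P v → Colored Q v
      agrees : ∀ {v} → Colored P v → color Q v ≡ color P v
  open _⊑_

  ⊑-refl : ∀ {P} → P ⊑ P
  ⊑-refl = record { grows = id ; agrees = λ _ → refl }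

  ⊑-trans : ∀ {P Q R} → P ⊑ Q → Q ⊑ R → P ⊑ R
  ⊑-trans e f = record { grows = grows f ∘ grows e
                       ; agrees = λ s → trans (agrees f (grows e s)) (agrees e s) }

  Admissible : Partial → Fin n → Fin k → Set
  Admissible P v d = (∀ {u} → Colored P u → Adj G v u → color P u ≢ d) × (d ≡ c₀ → Marked P v)

  -- c₁ is preferred: if it is unavailable, then v is marked and may receive c₀.
  admissible : ∀ P v → ∃ (Admissible P v)
  admissible P v with any? (λ u → colored? P u ×-dec adj? G v u ×-dec (color P u ≟ c₁))
  ... | yes v-marked =
    -- Fewer than `k` colors occur on `N v`, even counting the arbitrary values at uncolored
    -- neighbors.
    let d , d∉ = freshColor (map (color P) (N v))
                   (subst (_< k) (sym (length-map (color P) (N v))) (degree<k v))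
    in d , (λ _ v~u e → d∉ (subst (_∈ map (color P) (N v)) e (∈-map⁺ (color P) (∈N⁺ v~u)))) ,
       λ _ → v-marked
  ... | no ¬marked = c₁ , (λ s v~u e → ¬marked (_ , s , v~u , e)) ,
    λ c₁≡c₀ → contradiction (sym c₁≡c₀) c₀≢c₁

  -- What later arguments use of a coloring of N(p) in which `z` gets a prescribed color `c`. The
  -- field `lonely` will keep c₀ and c₁ away from children of `y` in the regular case.
  record Extension (P : Partial) (p z : Fin n) (c : Fin k) : Set₁ where
    field
      partial   : Partial
      extends   : P ⊑ partial
      neighbor  : ∀ {v} → Adj G p v → Colored partial v
      colored⁻  : ∀ {v} → Colored partial v → Colored P v ⊎ Adj G p v
      chosen    : color partial z ≡ c
      lonely    : ∀ {v} → Adj G p v → ¬ Colored P v → v ≢ z →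
                  (∀ {u} → u ≢ p → Colored P u → ¬ Adj G v u) →
                  color partial v ≢ c₀ × color partial v ≢ c

  -- An anchored vertex is fixed along with p since there are no 4-cycles, so only the remaining
  -- new vertices need pairwise different colors.
  module Batch (P : Partial) {p q z : Fin n} {c : Fin k}
    (p-colored : Colored P p) (q-colored : Colored P q) (p~q : Adj G p q)
    (p~z : Adj G p z) (z-uncolored : ¬ Colored P z)
    (c-proper : ∀ {u} → Colored P u → Adj G z u → color P u ≢ c)
    (c-marked : c ≡ c₀ → Exempt z ⊎ Marked P z) where

    Anchored : Fin n → Set
    Anchored v = ∃ λ u → u ≢ p × Colored P u × Adj G v u

    anchored? : Decidable Anchored
    anchored? v = any? λ u → ¬? (u ≟ p) ×-dec colored? P u ×-dec adj? G v u

    private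
      plain? : Decidable λ v → ¬ Colored P v × v ≢ z
      plain? v = ¬? (colored? P v) ×-dec ¬? (v ≟ z)

      ws : List (Fin n)
      ws = filter plain? (N p)

      ws⁻ : ∀ {v} → v ∈ ws → v ∈ N p × ¬ Colored P v × v ≢ z
      ws⁻ = ∈-filter⁻ plain?

      -- Both `z` and the colored vertex `q` are neighbors of `p` outside `ws`, so
      -- `2 + length ws ≤ degree G p < k`.
      ws-fits : 3 + length ws ≤ k
      ws-fits = ≤-trans (s≤s (length≤degree
        ( ((λ { refl → z-uncolored q-colored })
            ∷ All.tabulate λ w∈ z≡w → proj₂ (proj₂ (ws⁻ w∈)) (sym z≡w))
        ∷ (All.tabulate λ { w∈ refl → proj₁ (proj₂ (ws⁻ w∈)) q-colored })
        ∷ Unique.filter⁺ plain? (N-unique p))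
        (p~z ∷ p~q ∷ All.tabulate λ w∈ → ∈N⁻ (proj₁ (ws⁻ w∈))))) (degree<k p)

      -- Avoiding `c₀` makes a mark unnecessary, avoiding the color of `p` keeps the coloring
      -- proper, and avoiding `c` separates these vertices from `z`.
      rainbow-ws = rainbow c (c₀ ∷ color P p ∷ c ∷ []) ws ws-fits
      h = proj₁ rainbow-ws

      -- Indexed by the color itself, so that one match on `choose v` reveals both the color of `v`
      -- and the reason for it.
      data Choice (v : Fin n) : Fin k → Set where
        old    : Colored P v → Choice v (color P v)
        chosen : ¬ Colored P v → v ≡ z → Choice v c
        free   : ¬ Colored P v → v ≢ z → Anchored v → ∀ {d} → Admissible P v d → Choice v d
        lonely : ¬ Colored P v → v ≢ z → ¬ Anchored v → Choice v (h v)

      choose : ∀ v → ∃ (Choice v)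
      -- Uncolored vertices outside `N p` get a value too, but `Colored⁺` leaves them out.
      choose v with colored? P v | v ≟ z | anchored? v
      ... | yes s | _       | _     = _ , old s
      ... | no ¬s | yes v≡z | _     = _ , chosen ¬s v≡z
      ... | no ¬s | no v≢z  | yes a = _ , free ¬s v≢z a (proj₂ (admissible P v))
      ... | no ¬s | no v≢z  | no ¬a = _ , lonely ¬s v≢z ¬a

      color⁺ : Fin n → Fin k
      color⁺ v = proj₁ (choose v)

      Colored⁺ : Pred (Fin n) 0ℓ
      Colored⁺ v = Colored P v ⊎ Adj G p v

      color-old : ∀ {v} → Colored P v → color⁺ v ≡ color P v
      color-old {v} s with choose v
      ... | _ , old _ = refl
      ... | _ , chosen ¬s _ = contradiction s ¬s
      ... | _ , free ¬s _ _ _ = contradiction s ¬s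
      ... | _ , lonely ¬s _ _ = contradiction s ¬s

      plain-∈ : ∀ {v} → Adj G p v → ¬ Colored P v → v ≢ z → v ∈ ws
      plain-∈ p~v ¬s v≢z = ∈-filter⁺ plain? (∈N⁺ p~v) (¬s , v≢z)

      h-avoids : ∀ {v} → Adj G p v → ¬ Colored P v → v ≢ z → h v ∉ c₀ ∷ color P p ∷ c ∷ []
      h-avoids p~v ¬s v≢z = proj₂ (proj₂ rainbow-ws) (plain-∈ p~v ¬s v≢z)

      proper-new : ∀ {u v} → Colored P u → ¬ Colored P v → Adj G p v → Adj G v u → color P u ≢ color⁺ v
      proper-new {u} {v} su ¬sv p~v v~u with choose v
      ... | _ , old sv = contradiction sv ¬sv
      ... | _ , chosen _ refl = c-proper su v~u
      ... | _ , free _ _ _ (d-proper , _) = d-proper su v~u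
      ... | _ , lonely _ v≢z ¬a with u ≟ p
      ...   | yes refl = λ e → h-avoids p~v ¬sv v≢z (there (here (sym e)))
      ...   | no u≢p = contradiction (u , u≢p , su , v~u) ¬a

      new-adj : ∀ {v} → Colored⁺ v → ¬ Colored P v → Adj G p v
      new-adj (inj₁ s) ¬s = contradiction s ¬s
      new-adj (inj₂ a) _  = a

      old-or-new : ∀ {v} → Colored⁺ v → Colored P v ⊎ (¬ Colored P v × Adj G p v)
      old-or-new {v} sv with colored? P v
      ... | yes s = inj₁ s
      ... | no ¬s = inj₂ (¬s , new-adj sv ¬s)

      proper⁺ : ∀ {v w} → Colored⁺ v → Colored⁺ w → Adj G v w → color⁺ v ≢ color⁺ w
      proper⁺ sv sw v~w e with old-or-new sv | old-or-new sw
      ... | inj₁ s | inj₁ t = proper P s t v~w (trans (sym (color-old s)) (trans e (color-old t)))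
      ... | inj₁ s | inj₂ (¬t , p~w) = proper-new s ¬t p~w (symm G v~w) (trans (sym (color-old s)) e)
      ... | inj₂ (¬s , p~v) | inj₁ t = proper-new t ¬s p~v v~w (trans (sym (color-old t)) (sym e))
      -- Two new vertices are both adjacent to `p`, so an edge between them would close a triangle.
      ... | inj₂ (_ , p~v) | inj₂ (_ , p~w) = no-triangle p~v v~w (symm G p~w)

      lift-marked : ∀ {v} → Marked P v → ∃ λ u → Colored⁺ u × Adj G v u × color⁺ u ≡ c₁
      lift-marked (u , s , v~u , e) = u , inj₁ s , v~u , trans (color-old s) e

      lift : ∀ {v} → v ≡ r ⊎ Exempt v ⊎ Marked P v →
             v ≡ r ⊎ Exempt v ⊎ ∃ λ u → Colored⁺ u × Adj G v u × color⁺ u ≡ c₁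
      lift = Sum.map₂ (Sum.map₂ lift-marked)

      marked⁺ : ∀ {v} → Colored⁺ v → color⁺ v ≡ c₀ →
                v ≡ r ⊎ Exempt v ⊎ ∃ λ u → Colored⁺ u × Adj G v u × color⁺ u ≡ c₁
      marked⁺ {v} sv e with choose v
      ... | _ , old s = lift (marked P s e)
      ... | _ , chosen _ refl = lift (inj₂ (c-marked e))
      ... | _ , free _ _ _ (_ , d-marked) = lift (inj₂ (inj₂ (d-marked e)))
      ... | _ , lonely ¬s v≢z _ = contradiction (here e) (h-avoids (new-adj sv ¬s) ¬s v≢z)

      -- An unanchored new vertex is either `z`, of color `c`, or is colored by `h`, which is
      -- injective on `ws` and avoids `c`.
      lonely-injective : ∀ {v w} → Adj G p v → Adj G p w → ¬ Colored P v → ¬ Colored P w →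
                         ¬ Anchored v → ¬ Anchored w → color⁺ v ≡ color⁺ w → v ≡ w
      lonely-injective {v} {w} p~v p~w ¬s ¬t ¬a ¬b e with choose v | choose w
      ... | _ , old s        | _ = contradiction s ¬s
      ... | _                | _ , old t = contradiction t ¬t
      ... | _ , free _ _ a _ | _ = contradiction a ¬a
      ... | _                | _ , free _ _ b _ = contradiction b ¬b
      ... | _ , chosen _ v≡z | _ , chosen _ w≡z = trans v≡z (sym w≡z)
      ... | _ , chosen _ _   | _ , lonely _ w≢z _ =
        contradiction (there (there (here (sym e)))) (h-avoids p~w ¬t w≢z)
      ... | _ , lonely _ v≢z _ | _ , chosen _ _ =
        contradiction (there (there (here e))) (h-avoids p~v ¬s v≢z)
      ... | _ , lonely _ v≢z _ | _ , lonely _ w≢z _ =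
        proj₁ (proj₂ rainbow-ws) (plain-∈ p~v ¬s v≢z) (plain-∈ p~w ¬t w≢z) e

      module _ (α : Automorphism G) (base : Base α) (pres : Preserves Colored⁺ color⁺ α) where
        open Automorphisms α

        rigid-old : ∀ {v} → Colored P v → to v ≡ v
        rigid-old = rigid P α base λ v s t →
          trans (sym (color-old t)) (trans (pres v (inj₁ s) (inj₁ t)) (color-old s))

        rigid-anchored : ∀ {v} → Adj G p v → Anchored v → to v ≡ v
        rigid-anchored p~v (u , u≢p , s , v~u) =
          common-unique u≢p (fixed-adj (rigid-old s) (symm G v~u)) (fixed-adj (rigid-old p-colored) p~v)
            (symm G v~u) p~v

        rigid⁺ : ∀ {v} → Colored⁺ v → to v ≡ v
        rigid⁺ {v} sv with old-or-new sv | anchored? v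
        ... | inj₁ s | _ = rigid-old s
        ... | inj₂ (_ , p~v) | yes a = rigid-anchored p~v a
        ... | inj₂ (¬s , p~v) | no ¬a = image (old-or-new (inj₂ p~fv)) (anchored? (to v))
          where
          p~fv : Adj G p (to v)
          p~fv = fixed-adj (rigid-old p-colored) p~v

          -- If `to v` is old or anchored, it is itself fixed, and injectivity of `to` gives
          -- `to v ≡ v`. Otherwise `v` and `to v` are unanchored new vertices of the same color.
          image : Colored P (to v) ⊎ (¬ Colored P (to v) × Adj G p (to v)) → Dec (Anchored (to v)) →
                  to v ≡ v
          image (inj₁ t) _ = to-injective (rigid-old t)
          image (inj₂ _) (yes b) = to-injective (rigid-anchored p~fv b)
          image (inj₂ (¬t , _)) (no ¬b) =
            lonely-injective p~fv p~v ¬t ¬s ¬b ¬a (pres v sv (inj₂ p~fv))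

      batch : Partial
      batch = record
        { Colored  = Colored⁺
        ; colored? = λ v → colored? P v ⊎-dec adj? G p v
        ; color    = color⁺
        ; proper   = proper⁺
        ; linked   = λ { (inj₁ s) → Sum.map₂ (λ (q , t , a) → q , inj₁ t , a) (linked P s)
                       ; (inj₂ p~v) → inj₂ (p , inj₁ p-colored , symm G p~v) }
        ; marked   = marked⁺
        ; rigid    = rigid⁺
        }

      batch-chosen : color⁺ z ≡ c
      batch-chosen with choose z
      ... | _ , old s = contradiction s z-uncolored
      ... | _ , chosen _ _ = refl
      ... | _ , free _ z≢z _ _ = contradiction refl z≢z
      ... | _ , lonely _ z≢z _ = contradiction refl z≢z

      batch-lonely : ∀ {v} → Adj G p v → ¬ Colored P v → v ≢ z →
                     (∀ {u} → u ≢ p → Colored P u → ¬ Adj G v u) → color⁺ v ≢ c₀ × color⁺ v ≢ c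
      batch-lonely {v} p~v ¬s v≢z alone with choose v
      ... | _ , old s = contradiction s ¬s
      ... | _ , chosen _ v≡z = contradiction v≡z v≢z
      ... | _ , free _ _ (_ , u≢p , s , v~u) _ = contradiction v~u (alone u≢p s)
      ... | _ , lonely _ _ _ =
        (λ e → h-avoids p~v ¬s v≢z (here e)) , λ e → h-avoids p~v ¬s v≢z (there (there (here e)))

    extension : Extension P p z c
    extension = record
      { partial  = batch
      ; extends  = record { grows = inj₁ ; agrees = color-old }
      ; neighbor = inj₂
      ; colored⁻ = id
      ; chosen   = batch-chosen
      ; lonely   = batch-lonely
      }

  -- Exhausting a connected graph

  Rooted : Partial → Set
  Rooted P = Colored P r × (∀ {u} → Adj G r u → Colored P u)

  rooted-⊑ : ∀ {P Q} → P ⊑ Q → Rooted P → Rooted Q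
  rooted-⊑ P⊑Q (s , t) = grows P⊑Q s , grows P⊑Q ∘ t

  -- If `w` is uncolored, then `p` is not `r`, as N(r) is colored. Hence `linked` supplies a colored
  -- neighbor `q` of `p`, and `w` can play the role of `z` in a batch around `p`.
  cover-neighbor : ∀ {p w} P → Rooted P → Colored P p → Adj G p w → ∃ λ Q → P ⊑ Q × Colored Q w
  cover-neighbor {p} {w} P (_ , near) p-colored p~w with colored? P w | linked P p-colored
  ... | yes w-colored | _ = P , ⊑-refl , w-colored
  ... | no ¬s | inj₁ refl = contradiction (near p~w) ¬s
  ... | no ¬s | inj₂ (q , q-colored , p~q) =
    let _ , c-proper , c-marked = admissible P w
        open Extension (Batch.extension P p-colored q-colored p~q p~w ¬s c-proper (inj₂ ∘ c-marked))
    in partial , extends , neighbor p~w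

  cover-path : ∀ {p w} P → Rooted P → Colored P p → Star (Adj G) p w → ∃ λ Q → P ⊑ Q × Colored Q w
  cover-path P _ s ε = P , ⊑-refl , s
  cover-path P rooted s (p~u ◅ path) =
    let Q , P⊑Q , t = cover-neighbor P rooted s p~u
        R , Q⊑R , w-colored = cover-path Q (rooted-⊑ P⊑Q rooted) t path
    in R , ⊑-trans P⊑Q Q⊑R , w-colored

  -- The initial stage. Only `r` has color `c₀` here, so no marks are required yet.
  rooted-star : (g : Fin n → Fin k) → g r ≡ c₀ → (∀ {u} → Adj G r u → g u ≢ c₀) →
                (∀ α → Base α → Preserves (λ v → v ≡ r ⊎ Adj G r v) g α →
                   ∀ {v} → v ≡ r ⊎ Adj G r v → _≅_.to α v ≡ v) → Partial
  rooted-star g g-r g-near g-rigid = record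
    { Colored  = λ v → v ≡ r ⊎ Adj G r v
    ; colored? = λ v → (v ≟ r) ⊎-dec adj? G r v
    ; color    = g
    ; proper   = λ
        { (inj₁ refl) (inj₁ refl) v~w → contradiction refl (adj⇒≢ v~w)
        ; (inj₁ refl) (inj₂ r~w) _ e → g-near r~w (trans (sym e) g-r)
        ; (inj₂ r~v) (inj₁ refl) _ e → g-near r~v (trans e g-r)
        ; (inj₂ r~v) (inj₂ r~w) v~w → contradiction (symm G r~w) (no-triangle r~v v~w)
        }
    ; linked   = Sum.map₂ λ r~v → r , inj₁ refl , symm G r~v
    ; marked   = λ { (inj₁ e) _ → inj₁ e ; (inj₂ r~v) e → contradiction e (g-near r~v) }
    ; rigid    = g-rigid
    }

  module _ (reach : ∀ v → Star (Adj G) r v) where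

    cover : ∀ P → Rooted P → (vs : List (Fin n)) → ∃ λ Q → P ⊑ Q × All (Colored Q) vs
    cover P _ [] = P , ⊑-refl , []
    cover P rooted (v ∷ vs) =
      let Q , P⊑Q , ss = cover P rooted vs
          Q-rooted = rooted-⊑ P⊑Q rooted
          R , Q⊑R , s = cover-path Q Q-rooted (proj₁ Q-rooted) (reach v)
      in R , ⊑-trans P⊑Q Q⊑R , s ∷ All.map (grows Q⊑R) ss

    -- An automorphism preserving the colors fixes r, the only vertex colored c₀ without a neighbor
    -- colored c₁.
    complete : ∀ P → Rooted P → color P r ≡ c₀ → (∀ {u} → Adj G r u → color P u ≢ c₁) →
               (∀ {v} → Exempt v → Marked P v) →
               (∀ α → _≅_.to α r ≡ r → Preserves (Colored P) (color P) α → Base α) →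
               HasProperDistinguishingColoring G k
    complete P rooted@(r-colored , near) r-c₀ no-c₁ exempt base =
      color Q , (λ v w → proper Q (all v) (all w)) , dist
      where
      covering = cover P rooted (allFin n)
      Q = proj₁ covering
      P⊑Q = proj₁ (proj₂ covering)
      all : ∀ v → Colored Q v
      all v = All.lookup (proj₂ (proj₂ covering)) (∈-allFin v)

      dist : Distinguishing G (color Q)
      dist α pres v = rigid Q α (base α to-r pres-P) (λ u _ _ → pres u) (all v)
        where
        open Automorphisms α

        unmarked : ¬ ∃ λ u → Adj G (to r) u × color Q u ≡ c₁
        unmarked (u , fr~u , e) =
          -- Pulled back along `α`, the vertex `u` becomes a neighbor of `r` of color `c₁`.
          no-c₁ r~w (trans (sym (agrees P⊑Q (near r~w)))
                      (trans (sym (pres w)) (trans (cong (color Q) (to-from u)) e)))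
          where
          w = from u
          r~w : Adj G r w
          r~w = to-adj⁻ (subst (Adj G (to r)) (sym (to-from u)) fr~u)

        to-r : to r ≡ r
        to-r with marked Q (all (to r)) (trans (pres r) (trans (agrees P⊑Q r-colored) r-c₀))
        ... | inj₁ e = e
        ... | inj₂ (inj₂ (u , _ , a , e)) = contradiction (u , a , e) unmarked
        ... | inj₂ (inj₁ x) with exempt x
        ...   | u , s , a , e = contradiction (u , a , trans (agrees P⊑Q s) e) unmarked

        pres-P : Preserves (Colored P) (color P) α
        pres-P u s t = trans (sym (agrees P⊑Q t)) (trans (pres u) (agrees P⊑Q s))

-- Maximum degree at most one, and roots of less than maximum degree

module _ (G : Graph n) (girth≥5 : Girth≥5 G) (connected : ∀ v w → Star (Adj G) v w) where

  open Neighbors G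
  open Girth≥5 girth≥5

  -- A walk from `r` cannot leave `r ∷ N r`, because a neighbor of `r` has no second neighbor.
  small : (∀ v → degree G v ≤ 1) → Fin n → n ≤ Δ G + 1
  small degree≤1 r = subst (n ≤_) (+-comm 1 (Δ G)) (≤-trans
    (≤-reflexive (sym (length-tabulate id)))
    (≤-trans (unique-⊆⇒length≤ {ys = r ∷ N r} (Unique.allFin⁺ n) λ {v} _ → near (inj₁ refl) (connected r v))
      (s≤s (degree≤Δ r))))
    where
    near : ∀ {v w} → v ≡ r ⊎ Adj G r v → Star (Adj G) v w → w ∈ r ∷ N r
    near (inj₁ e) ε = here e
    near (inj₂ r~v) ε = there (∈N⁺ r~v)
    near (inj₁ refl) (r~u ◅ path) = near (inj₂ r~u) path
    near {v} (inj₂ r~v) (_◅_ {j = u} v~u path) with u ≟ r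
    ... | yes u≡r = near (inj₁ u≡r) path
    ... | no u≢r = contradiction (degree≤1 v)
      (<⇒≱ (length≤degree ((u≢r ∷ []) ∷ [] ∷ []) (v~u ∷ symm G r~v ∷ [])))

  module _ (degree<k : ∀ v → degree G v < k) {c₀ c₁ : Fin k} (c₀≢c₁ : c₀ ≢ c₁) where

    -- The bound on the degree leaves room for a rainbow on `N r` that avoids both `c₀` and `c₁`.
    irregular : ∀ r → 2 + degree G r ≤ k → HasProperDistinguishingColoring G k
    irregular r fits = complete (connected r) star (inj₁ refl , inj₂) g-r (proj₂ ∘ g-near) (λ ()) λ _ e _ → e
      where
      open Greedy G girth≥5 degree<k r (λ α → _≅_.to α r ≡ r) (λ _ → ⊥) c₀ c₁ c₀≢c₁

      rainbow-N = rainbow c₀ (c₀ ∷ c₁ ∷ []) (N r) fits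
      h = proj₁ rainbow-N
      g : Fin n → Fin k
      g = updateAt h r (const c₀)

      g-r : g r ≡ c₀
      g-r = updateAt-updates r h

      g-h : ∀ {u} → Adj G r u → g u ≡ h u
      g-h r~u = updateAt-minimal _ r h (≢-sym (adj⇒≢ r~u))

      g-near : ∀ {u} → Adj G r u → g u ≢ c₀ × g u ≢ c₁
      g-near r~u =
        (λ e → proj₂ (proj₂ rainbow-N) (∈N⁺ r~u) (here (trans (sym (g-h r~u)) e))) ,
        (λ e → proj₂ (proj₂ rainbow-N) (∈N⁺ r~u) (there (here (trans (sym (g-h r~u)) e))))

      star : Partial
      star = rooted-star g g-r (proj₁ ∘ g-near) λ
        { α to-r _ (inj₁ refl) → to-r
        ; α to-r pres (inj₂ r~v) → let r~fv = Automorphisms.fixed-adj α to-r r~v in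
            proj₁ (proj₂ rainbow-N) (∈N⁺ r~fv) (∈N⁺ r~v)
              (trans (sym (g-h r~fv)) (trans (pres _ (inj₂ r~v) (inj₂ r~fv)) (g-h r~v))) }

    -- Two neighbors of the root with the same color

    -- The neighbor z of x receives c₀, which no neighbor of y other than r does.
    module Twins {r x y z y′ : Fin n}
      (r~x : Adj G r x) (r~y : Adj G r y) (x≢y : x ≢ y) (x~z : Adj G x z) (z≢r : z ≢ r)
      (y~y′ : Adj G y y′) (y′≢r : y′ ≢ r) where

      private
        Base : Automorphism G → Set
        Base α = to r ≡ r × to x ≡ x
          where open _≅_ α

      open Greedy G girth≥5 degree<k r Base (_≡ z) c₀ c₁ c₀≢c₁
      open Partial
      open _⊑_

      private
        ≢y? : Decidable (_≢ y)
        ≢y? v = ¬? (v ≟ y)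

        ws : List (Fin n)
        ws = filter ≢y? (N r)

        -- Leaving out `y`, which copies the color of `x`, makes room for `c₀` and `c₁` even when
        -- `r` has degree `k - 1`.
        ws-fits : 2 + length ws ≤ k
        ws-fits = ≤-trans (s≤s (length≤degree
          (All.tabulate (λ w∈ y≡w → proj₂ (∈-filter⁻ ≢y? {xs = N r} w∈) (sym y≡w))
            ∷ Unique.filter⁺ ≢y? (N-unique r))
          (r~y ∷ All.tabulate λ w∈ → ∈N⁻ (proj₁ (∈-filter⁻ ≢y? w∈))))) (degree<k r)

        rainbow-ws = rainbow c₀ (c₀ ∷ c₁ ∷ []) ws ws-fits
        h = proj₁ rainbow-ws

        h′ g : Fin n → Fin k
        h′ = updateAt h y (const (h x))
        g = updateAt h′ r (const c₀)

        ∈ws : ∀ {u} → Adj G r u → u ≢ y → u ∈ ws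
        ∈ws r~u u≢y = ∈-filter⁺ ≢y? (∈N⁺ r~u) u≢y

        g-r : g r ≡ c₀
        g-r = updateAt-updates r h′

        g-h : ∀ {u} → Adj G r u → u ≢ y → g u ≡ h u
        g-h r~u u≢y = trans (updateAt-minimal _ r h′ (≢-sym (adj⇒≢ r~u))) (updateAt-minimal _ y h u≢y)

        g-y : g y ≡ h x
        g-y = trans (updateAt-minimal y r h′ (≢-sym (adj⇒≢ r~y))) (updateAt-updates y h)

        g-injective : ∀ {u v} → Adj G r u → Adj G r v → u ≢ y → v ≢ y → g u ≡ g v → u ≡ v
        g-injective r~u r~v u≢y v≢y e = proj₁ (proj₂ rainbow-ws) (∈ws r~u u≢y) (∈ws r~v v≢y)
          (trans (sym (g-h r~u u≢y)) (trans e (g-h r~v v≢y)))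

        g-y⁻ : ∀ {u} → Adj G r u → u ≢ y → g u ≡ g y → u ≡ x
        g-y⁻ r~u u≢y e = proj₁ (proj₂ rainbow-ws) (∈ws r~u u≢y) (∈ws r~x x≢y)
          (trans (sym (g-h r~u u≢y)) (trans e g-y))

        g-avoids : ∀ {u} → Adj G r u → g u ∉ c₀ ∷ c₁ ∷ []
        g-avoids {u} r~u g∈ with u ≟ y
        ... | yes refl = proj₂ (proj₂ rainbow-ws) (∈ws r~x x≢y) (subst (_∈ _) g-y g∈)
        ... | no u≢y = proj₂ (proj₂ rainbow-ws) (∈ws r~u u≢y) (subst (_∈ _) (g-h r~u u≢y) g∈)

        g≢c₀ : ∀ {u} → Adj G r u → g u ≢ c₀
        g≢c₀ r~u e = g-avoids r~u (here e)

        g≢c₁ : ∀ {u} → Adj G r u → g u ≢ c₁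
        g≢c₁ r~u e = g-avoids r~u (there (here e))

        -- Only `x` and `y` share a color in N(r), and `Base` already fixes `x`.
        g-rigid : ∀ α → Base α → Preserves (λ v → v ≡ r ⊎ Adj G r v) g α →
                  ∀ {v} → v ≡ r ⊎ Adj G r v → _≅_.to α v ≡ v
        g-rigid α (to-r , _) _ (inj₁ refl) = to-r
        g-rigid α (to-r , to-x) pres {v} (inj₂ r~v) with v ≟ y | _≅_.to α v ≟ y
        ... | yes v≡y  | yes fv≡y = trans fv≡y (sym v≡y)
        ... | no v≢y   | no fv≢y  = g-injective r~fv r~v fv≢y v≢y (pres v (inj₂ r~v) (inj₂ r~fv))
          where r~fv = Automorphisms.fixed-adj α to-r r~v
        ... | yes refl | no fv≢y  = contradiction (sym y≡x) x≢y
          where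
          r~fv = Automorphisms.fixed-adj α to-r r~v
          y≡x : y ≡ x
          y≡x = Automorphisms.to-injective α
            (trans (g-y⁻ r~fv fv≢y (pres v (inj₂ r~v) (inj₂ r~fv))) (sym to-x))
        ... | no v≢y   | yes fv≡y = subst (λ u → _≅_.to α u ≡ u) (sym v≡x) to-x
          where
          r~fv = Automorphisms.fixed-adj α to-r r~v
          v≡x : v ≡ x
          v≡x = g-y⁻ r~v v≢y (trans (sym (pres v (inj₂ r~v) (inj₂ r~fv))) (cong g fv≡y))

        abstract
          P₁ : Partial
          P₁ = rooted-star g g-r g≢c₀ g-rigid

          P₁-colored : ∀ {v} → v ≡ r ⊎ Adj G r v → Colored P₁ v
          P₁-colored s = s

          P₁-colored⁻ : ∀ {v} → Colored P₁ v → v ≡ r ⊎ Adj G r v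
          P₁-colored⁻ s = s

          P₁-r : color P₁ r ≡ c₀
          P₁-r = g-r

          P₁≢c₀ : ∀ {u} → Adj G r u → color P₁ u ≢ c₀
          P₁≢c₀ = g≢c₀

          P₁≢c₁ : ∀ {u} → Adj G r u → color P₁ u ≢ c₁
          P₁≢c₁ = g≢c₁

          P₁-injective : ∀ {u v} → Adj G r u → Adj G r v → u ≢ y → v ≢ y →
                         color P₁ u ≡ color P₁ v → u ≡ v
          P₁-injective = g-injective

        y′≁r : ¬ Adj G y′ r
        y′≁r = no-triangle r~y y~y′

        z≁r : ¬ Adj G z r
        z≁r = no-triangle r~x x~z

        child-uncolored : ∀ {p v} → Adj G r p → Adj G p v → v ≢ r → ¬ Colored P₁ v
        child-uncolored r~p p~v v≢r s with P₁-colored⁻ s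
        ... | inj₁ v≡r = v≢r v≡r
        ... | inj₂ r~v = no-triangle r~p p~v (symm G r~v)

        y′-proper : ∀ {u} → Colored P₁ u → Adj G y′ u → color P₁ u ≢ c₁
        y′-proper s y′~u with P₁-colored⁻ s
        ... | inj₁ refl = contradiction y′~u y′≁r
        ... | inj₂ r~u = P₁≢c₁ r~u

        abstract
          -- The color `c₁` at `y′` marks `z` if they are adjacent. Being prescribed, it is avoided
          -- by the other children of `y`, which frees it for `z′` in `no-hexagon`.
          E₂ : Extension P₁ y y′ c₁
          E₂ = Batch.extension P₁ (P₁-colored (inj₂ r~y)) (P₁-colored (inj₁ refl)) (symm G r~y) y~y′
            (child-uncolored r~y y~y′ y′≢r) y′-proper (λ e → contradiction (sym e) c₀≢c₁)

        module E₂ = Extension E₂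

        P₂ : Partial
        P₂ = E₂.partial

        alone : ∀ {v} → Adj G y v → v ≢ r → ∀ {u} → u ≢ y → Colored P₁ u → ¬ Adj G v u
        alone y~v v≢r u≢y s v~u with P₁-colored⁻ s
        ... | inj₁ refl = no-triangle r~y y~v v~u
        ... | inj₂ r~u = u≢y (common-unique (≢-sym v≢r) r~u v~u r~y (symm G y~v))

        child-colors : ∀ {v} → Adj G y v → v ≢ r → v ≢ y′ → color P₂ v ≢ c₀ × color P₂ v ≢ c₁
        child-colors y~v v≢r v≢y′ = E₂.lonely y~v (child-uncolored r~y y~v v≢r) v≢y′ (alone y~v v≢r)

        child≢c₀ : ∀ {v} → Adj G y v → v ≢ r → color P₂ v ≢ c₀
        child≢c₀ {v} y~v v≢r e with toSum (v ≟ y′)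
        ... | inj₁ refl = c₀≢c₁ (trans (sym e) E₂.chosen)
        ... | inj₂ v≢y′ = proj₁ (child-colors y~v v≢r v≢y′) e

        z-uncolored₂ : ¬ Colored P₂ z
        z-uncolored₂ s with E₂.colored⁻ s
        ... | inj₁ t = child-uncolored r~x x~z z≢r t
        ... | inj₂ y~z = x≢y (common-unique (≢-sym z≢r) r~x (symm G x~z) r~y (symm G y~z))

        z-proper : ∀ {u} → Colored P₂ u → Adj G z u → color P₂ u ≢ c₀
        z-proper s z~u e with E₂.colored⁻ s
        ... | inj₂ y~u = child≢c₀ y~u (λ { refl → z≁r z~u }) e
        ... | inj₁ t with P₁-colored⁻ t
        ...   | inj₁ refl = z≁r z~u
        ...   | inj₂ r~u = P₁≢c₀ r~u (trans (sym (agrees E₂.extends t)) e)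

        abstract
          -- Here `z` takes `c₀` on credit: it stays exempt until `finish` receives its mark.
          E₃ : Extension P₂ x z c₀
          E₃ = Batch.extension P₂ (grows E₂.extends (P₁-colored (inj₂ r~x)))
            (grows E₂.extends (P₁-colored (inj₁ refl))) (symm G r~x) x~z z-uncolored₂ z-proper (λ _ → inj₁ refl)

        module E₃ = Extension E₃

        P₃ : Partial
        P₃ = E₃.partial

        P₁⊑P₃ : P₁ ⊑ P₃
        P₁⊑P₃ = ⊑-trans E₂.extends E₃.extends

        -- Once `r` is fixed, colors allow `x` to go only to `x` or `y`. In the latter case `z`
        -- would go to a child of `y` of color `c₀`, and there is none.
        finish : ∀ P → P₃ ⊑ P → Marked P z → HasProperDistinguishingColoring G k
        finish P P₃⊑P z-marked = complete (connected r) P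
          (P₁-in-P (inj₁ refl) , P₁-in-P ∘ inj₂) (trans (agrees P₁⊑P (P₁-colored (inj₁ refl))) P₁-r)
          (λ r~u e → P₁≢c₁ r~u (trans (sym (agrees P₁⊑P (P₁-colored (inj₂ r~u)))) e))
          (λ { refl → z-marked }) λ α to-r pres → to-r , to-x α to-r pres
          where
          P₁⊑P : P₁ ⊑ P
          P₁⊑P = ⊑-trans P₁⊑P₃ P₃⊑P
          P₂⊑P : P₂ ⊑ P
          P₂⊑P = ⊑-trans E₃.extends P₃⊑P

          P₁-in-P : ∀ {v} → v ≡ r ⊎ Adj G r v → Colored P v
          P₁-in-P s = grows P₁⊑P (P₁-colored s)

          to-x : ∀ α → _≅_.to α r ≡ r → Preserves (Colored P) (color P) α → _≅_.to α x ≡ x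
          to-x α to-r pres with toSum (_≅_.to α x ≟ y)
          ... | inj₂ fx≢y = P₁-injective r~fx r~x fx≢y x≢y
            (trans (sym (agrees P₁⊑P (P₁-colored (inj₂ r~fx))))
              (trans (pres x (P₁-in-P (inj₂ r~x)) (P₁-in-P (inj₂ r~fx)))
                (agrees P₁⊑P (P₁-colored (inj₂ r~x)))))
            where r~fx = Automorphisms.fixed-adj α to-r r~x
          ... | inj₁ fx≡y = contradiction fz-c₀ (child≢c₀ y~fz fz≢r)
            where
            open Automorphisms α
            y~fz : Adj G y (to z)
            y~fz = subst (λ u → Adj G u (to z)) fx≡y (Equivalence.to (preserves x z) x~z)
            fz≢r : to z ≢ r
            fz≢r e = z≢r (to-injective (trans e (sym to-r)))
            fz-c₀ : color P₂ (to z) ≡ c₀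
            fz-c₀ = trans (sym (agrees P₂⊑P (E₂.neighbor y~fz)))
              (trans (pres z (grows P₃⊑P (E₃.neighbor x~z)) (grows P₂⊑P (E₂.neighbor y~fz)))
                (trans (agrees P₃⊑P (E₃.neighbor x~z)) E₃.chosen))

      -- The 5-cycle through `r`, `x`, `z`, `y′` and `y` supplies the mark: `y′` already has color
      -- `c₁`.
      pentagon : Adj G z y′ → HasProperDistinguishingColoring G k
      pentagon z~y′ = finish P₃ ⊑-refl (y′ , grows E₃.extends (E₂.neighbor y~y′) , z~y′ ,
        trans (agrees E₃.extends (E₂.neighbor y~y′)) E₂.chosen)

      -- Coloring N(z) with `c₁` at `z′` supplies the mark. This is proper: among N(x), only `z` is
      -- adjacent to `z′`, and of the children of `y` only `y′`, excluded by hypothesis, has color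
      -- `c₁`.
      no-hexagon : ∀ {z′} → Adj G z z′ → z′ ≢ x → ¬ Adj G y z′ → ¬ Adj G z′ y′ →
                   HasProperDistinguishingColoring G k
      no-hexagon {z′} z~z′ z′≢x y≁z′ z′≁y′ =
        finish E₄.partial E₄.extends (z′ , E₄.neighbor z~z′ , z~z′ , E₄.chosen)
        where
        r≁z′ : ¬ Adj G r z′
        r≁z′ r~z′ = z′≢x (sym (common-unique (≢-sym z≢r) r~x (symm G x~z) r~z′ z~z′))

        z′-uncolored : ¬ Colored P₃ z′
        z′-uncolored s with E₃.colored⁻ s
        ... | inj₂ x~z′ = no-triangle x~z z~z′ (symm G x~z′)
        ... | inj₁ t with E₂.colored⁻ t
        ...   | inj₂ y~z′ = y≁z′ y~z′
        ...   | inj₁ w with P₁-colored⁻ w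
        ...     | inj₁ refl = z≁r z~z′
        ...     | inj₂ r~z′ = r≁z′ r~z′

        z′-proper : ∀ {u} → Colored P₃ u → Adj G z′ u → color P₃ u ≢ c₁
        z′-proper s z′~u e with E₃.colored⁻ s
        ... | inj₂ x~u = c₀≢c₁ (trans (sym E₃.chosen)
          (subst (λ v → color P₃ v ≡ c₁) (common-unique (≢-sym z′≢x) x~u z′~u x~z (symm G z~z′)) e))
        ... | inj₁ t with E₂.colored⁻ t
        ...   | inj₂ y~u = proj₂ (child-colors y~u (λ { refl → r≁z′ (symm G z′~u) }) λ { refl → z′≁y′ z′~u })
                (trans (sym (agrees E₃.extends t)) e)
        ...   | inj₁ w with P₁-colored⁻ w
        ...     | inj₁ refl = r≁z′ (symm G z′~u)
        ...     | inj₂ r~u = P₁≢c₁ r~u (trans (sym (agrees P₁⊑P₃ w)) e)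

        E₄ : Extension P₃ z z′ c₁
        E₄ = Batch.extension P₃ (E₃.neighbor x~z) (grows P₁⊑P₃ (P₁-colored (inj₂ r~x))) (symm G x~z) z~z′
          z′-uncolored z′-proper (λ e → contradiction (sym e) c₀≢c₁)

        module E₄ = Extension E₄

  -- Recognition of the 6-cycle

  -- Without triangles, a closed walk of length six that never turns back is a 6-cycle; when all
  -- degrees are at most 2, connectedness makes it the whole graph.
  module Hexagon (c : Fin 6 → Fin n) (c-next : ∀ i → Adj G (c i) (c (next i)))
                 (c-back : ∀ i → c i ≢ c (next (next i))) (degree≤2 : ∀ v → degree G v ≤ 2) where

    private
      prev : Fin 6 → Fin 6
      prev i = next (next (next (next (next i))))

      next-prev : ∀ i → next (prev i) ≡ i
      next-prev = from-yes (all? {n = 6} λ i → next (prev i) ≟ i)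

      distance : ∀ i j → j ≡ i ⊎ j ≡ next i ⊎ i ≡ next j ⊎ j ≡ next (next i) ⊎ i ≡ next (next j) ⊎
                         j ≡ next (next (next i))
      distance = from-yes (all? {n = 6} λ i → all? {n = 6} λ j → (j ≟ i) ⊎-dec (j ≟ next i) ⊎-dec (i ≟ next j) ⊎-dec
        (j ≟ next (next i)) ⊎-dec (i ≟ next (next j)) ⊎-dec (j ≟ next (next (next i))))

      c-injective : ∀ {i j} → c i ≡ c j → i ≡ j
      c-injective {i} {j} e with distance i j
      ... | inj₁ j≡i = sym j≡i
      ... | inj₂ (inj₁ refl) = contradiction e (adj⇒≢ (c-next i))
      ... | inj₂ (inj₂ (inj₁ refl)) = contradiction (sym e) (adj⇒≢ (c-next j))
      ... | inj₂ (inj₂ (inj₂ (inj₁ refl))) = contradiction e (c-back i)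
      ... | inj₂ (inj₂ (inj₂ (inj₂ (inj₁ refl)))) = contradiction (sym e) (c-back j)
      -- If opposite vertices coincide, the three edges between them form a triangle.
      ... | inj₂ (inj₂ (inj₂ (inj₂ (inj₂ refl)))) = contradiction
        (subst (Adj G (c (next (next i)))) (sym e) (c-next (next (next i))))
        (no-triangle (c-next i) (c-next (next i)))

      c-prev : ∀ i → Adj G (c i) (c (prev i))
      c-prev i = symm G (subst (Adj G (c (prev i)) ∘ c) (next-prev i) (c-next (prev i)))

      neighbor : ∀ i {w} → Adj G (c i) w → w ≡ c (next i) ⊎ w ≡ c (prev i)
      neighbor i {w} a with w ≟ c (next i) | w ≟ c (prev i)
      ... | yes e | _ = inj₁ e
      ... | _ | yes e = inj₂ e
      ... | no w≢next | no w≢prev = contradiction (degree≤2 (c i)) (<⇒≱ (length≤degree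
        ((w≢next ∷ w≢prev ∷ []) ∷ (next≢prev ∷ []) ∷ [] ∷ []) (a ∷ c-next i ∷ c-prev i ∷ [])))
        where
        next≢prev : c (next i) ≢ c (prev i)
        next≢prev e = c-back (prev i) (trans (sym e) (cong (c ∘ next) (sym (next-prev i))))

      onto-path : ∀ {v w} → (∃ λ i → c i ≡ v) → Star (Adj G) v w → ∃ λ i → c i ≡ w
      onto-path onto ε = onto
      onto-path (i , refl) (a ◅ path) with neighbor i a
      ... | inj₁ e = onto-path (next i , sym e) path
      ... | inj₂ e = onto-path (prev i , sym e) path

      onto : ∀ v → ∃ λ i → c i ≡ v
      onto v = onto-path (zero , refl) (connected (c zero) v)

      index : Fin n → Fin 6
      index v = proj₁ (onto v)

      c-index : ∀ v → c (index v) ≡ v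
      c-index v = proj₂ (onto v)

      index-c : ∀ {i v} → v ≡ c i → index v ≡ i
      index-c {v = v} e = c-injective (trans (c-index v) e)

      forth : ∀ {v w} → Adj G v w → Adj C₆ (index v) (index w)
      forth {v} {w} a with neighbor (index v) (subst (λ u → Adj G u w) (sym (c-index v)) a)
      ... | inj₁ e = inj₁ (index-c e)
      ... | inj₂ e = inj₂ (trans (sym (next-prev (index v))) (cong next (sym (index-c e))))

      next-adj : ∀ {v w} → index w ≡ next (index v) → Adj G v w
      next-adj {v} {w} e = subst₂ (Adj G) (c-index v) (trans (cong c (sym e)) (c-index w)) (c-next (index v))

    iso : G ≅ C₆
    iso = record
      { bijection = mk↔ₛ′ index c (λ i → index-c refl) c-index
      ; preserves = λ v w → mk⇔ forth λ { (inj₁ e) → next-adj e ; (inj₂ e) → symm G (next-adj e) }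
      }

  -- Regular graphs: cases along the walk y, r, x, z, z′

  module Walk {r x y z z′ : Fin n} (r~x : Adj G r x) (r~y : Adj G r y) (x≢y : x ≢ y)
    (x~z : Adj G x z) (z≢r : z ≢ r) (z~z′ : Adj G z z′) (z′≢x : z′ ≢ x) where

    closes : ∀ {y′} → Adj G y y′ → y′ ≢ r → Adj G z′ y′ → (∀ v → degree G v ≤ 2) → G ≅ C₆
    closes {y′} y~y′ y′≢r z′~y′ degree≤2 = Hexagon.iso c c-next c-back degree≤2
      where
      c : Fin 6 → Fin n
      c = r ∷ᶠ x ∷ᶠ z ∷ᶠ z′ ∷ᶠ y′ ∷ᶠ y ∷ᶠ []ᶠ

      c-next : ∀ i → Adj G (c i) (c (next i))
      c-next 0F = r~x
      c-next 1F = x~z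
      c-next 2F = z~z′
      c-next 3F = z′~y′
      c-next 4F = symm G y~y′
      c-next 5F = symm G r~y

      no-square : ∀ {v} → Adj G z v → v ≢ x → ¬ Adj G r v
      no-square z~v v≢x r~v = v≢x (common-unique (≢-sym z≢r) r~v z~v r~x (symm G x~z))

      c-back : ∀ i → c i ≢ c (next (next i))
      c-back 0F = ≢-sym z≢r
      c-back 1F = ≢-sym z′≢x
      -- In this case and the next, `y` would be a common neighbor of `r` and `z` other than `x`.
      c-back 2F refl = no-square (symm G y~y′) (≢-sym x≢y) r~y
      c-back 3F refl = no-square z~z′ z′≢x r~y
      c-back 4F = y′≢r
      c-back 5F = ≢-sym x≢y

    -- Either `y` and `z` have a common neighbor, or some child of `y` is not adjacent to `z′`, or
    -- `z′` is adjacent to all children of `y`. In the last case there is just one child, as there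
    -- are no 4-cycles, so the graph is 2-regular and a hexagon.
    color-walk : (∀ v → degree G v < k) → {c₀ c₁ : Fin k} → c₀ ≢ c₁ → (∀ v → degree G v ≡ m) →
                 2 ≤ m → ¬ G ≅ C₆ → HasProperDistinguishingColoring G k
    color-walk {k = k} degree<k c₀≢c₁ degree≡m 2≤m G≇C₆ with any? (λ u → adj? G y u ×-dec adj? G z u)
    ... | yes (y′ , y~y′ , z~y′) = Twins.pentagon degree<k c₀≢c₁ r~x r~y x≢y x~z z≢r y~y′
      (λ { refl → no-triangle r~x x~z z~y′ }) z~y′
    ... | no none with any? (λ u → adj? G y u ×-dec ¬? (u ≟ r) ×-dec ¬? (adj? G z′ u))
    ...   | yes (y′ , y~y′ , y′≢r , z′≁y′) =
      Twins.no-hexagon degree<k c₀≢c₁ r~x r~y x≢y x~z z≢r y~y′ y′≢r z~z′ z′≢x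
        (λ y~z′ → none (z′ , y~z′ , z~z′)) z′≁y′
    ...   | no none′ =
      let y′ , y~y′ , y′∉ = anotherNeighbor y (r ∷ []) (subst (2 ≤_) (sym (degree≡m y)) 2≤m)
          y′≢r = y′∉ ∘ here
      in contradiction (closes y~y′ y′≢r (z′~child y~y′ y′≢r) (degree≤2 y~y′ y′≢r)) G≇C₆
      where
      z′~child : ∀ {u} → Adj G y u → u ≢ r → Adj G z′ u
      z′~child y~u u≢r = decidable-stable (adj? G z′ _) λ z′≁u → none′ (_ , y~u , u≢r , z′≁u)

      y≢z′ : y ≢ z′
      y≢z′ refl = x≢y (common-unique (≢-sym z≢r) r~x (symm G x~z) r~y z~z′)

      degree≤2 : ∀ {y′} → Adj G y y′ → y′ ≢ r → ∀ v → degree G v ≤ 2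
      degree≤2 {y′} y~y′ y′≢r v = ≤-trans (≤-reflexive (trans (degree≡m v) (sym (degree≡m y))))
        (≮⇒≥ λ 2<degree →
          let u , y~u , u∉ = anotherNeighbor y (r ∷ y′ ∷ []) 2<degree
              z′~u = z′~child y~u (u∉ ∘ here)
          in u∉ (there (here (common-unique y≢z′ y~u z′~u y~y′ (z′~child y~y′ y′≢r)))))

  regular : (∀ v → degree G v < k) → {c₀ c₁ : Fin k} → c₀ ≢ c₁ → (∀ v → degree G v ≡ m) →
            2 ≤ m → ¬ G ≅ C₆ → Fin n → HasProperDistinguishingColoring G k
  regular degree<k c₀≢c₁ degree≡m 2≤m G≇C₆ r =
    -- Excluding `r` from its own neighbors is vacuous: `x` is an arbitrary neighbor.
    let x , r~x , _ = neighbor≢ r r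
        y , r~y , y≢x = neighbor≢ r x
        z , x~z , z≢r = neighbor≢ x r
        z′ , z~z′ , z′≢x = neighbor≢ z x
    in Walk.color-walk r~x r~y (≢-sym y≢x) x~z z≢r z~z′ z′≢x degree<k c₀≢c₁ degree≡m 2≤m G≇C₆
    where
    neighbor≢ : ∀ v w → ∃ λ u → Adj G v u × u ≢ w
    neighbor≢ v w =
      let u , v~u , u∉ = anotherNeighbor v (w ∷ []) (subst (2 ≤_) (sym (degree≡m v)) 2≤m)
      in u , v~u , u∉ ∘ here

-- Case distinction on the degrees

theorem1 : ∀ {n : ℕ} (G : Graph n) → Connected G → [ 5 ] ≤⁺ girth G →
    ¬ (G ≅ C₆) → χ-D G ≤ Δ G + 1
theorem1 {n} G (r , connected) 5≤girth G≇C₆ = bound (Δ G ≤? 1) (any? λ v → degree G v <? Δ G)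
  where
  open Neighbors G
  girth≥5 = girth≥5⇒Girth≥5 G (girth-exists G) 5≤girth
  χ-D-least = proj₂ (proj₂ (χ-D-exists G))

  degree<Δ+1 : ∀ v → degree G v < Δ G + 1
  degree<Δ+1 v = subst (degree G v <_) (+-comm 1 (Δ G)) (s≤s (degree≤Δ v))

  bound : Dec (Δ G ≤ 1) → Dec (∃ λ v → degree G v < Δ G) → χ-D G ≤ Δ G + 1
  bound (yes Δ≤1) _ = ≤-trans
    -- With at most `Δ G + 1` vertices, giving each its own color is enough.
    (χ-D-least n (id , (λ v w a e → irrefl G e a) , λ _ fix → fix))
    (small G girth≥5 connected (λ v → ≤-trans (degree≤Δ v) Δ≤1) r)
  bound (no Δ≰1) any-smaller = χ-D-least (Δ G + 1) (coloring any-smaller)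
    where
    c₀≢c₁ = proj₂ (proj₂ (twoColors (≤-trans (≰⇒> Δ≰1) (m≤m+n (Δ G) 1))))

    coloring : Dec (∃ λ v → degree G v < Δ G) → HasProperDistinguishingColoring G (Δ G + 1)
    coloring (yes (v , deg<Δ)) = irregular G girth≥5 connected degree<Δ+1 c₀≢c₁ v
      (subst (2 + degree G v ≤_) (+-comm 1 (Δ G)) (s≤s deg<Δ))
    coloring (no all-Δ) = regular G girth≥5 connected degree<Δ+1 c₀≢c₁
      (λ v → ≤-antisym (degree≤Δ v) (≮⇒≥ λ deg<Δ → all-Δ (v , deg<Δ))) (≰⇒> Δ≰1) G≇C₆ r
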